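{- Let $\Phi\cup\{\psi\}\subseteq\mathcal L$ and let $\Phi^n=\{\varphi^n\mid\varphi\in\Phi\}$, where for a formula $\varphi$ with $\mathcal R(\varphi)=\{\alpha_1,\dots,\alpha_k\}$ we put $\varphi^n:=\neg\neg\alpha_1\sqcup\dots\sqcup\neg\neg\alpha_k$. Then $\Phi\models_{\mathsf{InqB}^\lor}\psi$ if and only if $\Phi^n\models_{\mathsf{InqI}}\psi^n$.
   Context: Fix a set $\mathcal P$ of atomic sentences. The language $\mathcal L$ is given by $\varphi::=p\mid\bot\mid\varphi\land\varphi\mid\varphi\lor\varphi\mid\varphi\to\varphi\mid\varphi\sqcup\varphi$ with $p\in\mathcal P$, where $\lor$ is standard disjunction and $\sqcup$ denotes inquisitive disjunction; $\neg\varphi:=\varphi\to\bot$. Intuitionistic semantics ($\mathsf{InqI}$). An intuitionistic Kripke model is $M=\langle W,R,V\rangle$ with $W$ a set (of worlds), $R$ a partial order on $W$, and $V:W\times\mathcal P\to\{0,1\}$ such that $wRw'$ and $V(w,p)=1$ imply $V(w',p)=1$. A team is a set $t\subseteq W$; $R[w]=\{w'\mid wRw'\}$ and $R[t]=\bigcup_{w\in t}R[w]$. Support $M,t\models\varphi$ is defined by: - $M,t\models p$ iff $V(w,p)=1$ for all $w\in t$; - $M,t\models\bot$ iff $t=\emptyset$; - $M,t\models\varphi\land\psi$ iff $M,t\models\varphi$ and $M,t\models\psi$; - $M,t\models\varphi\lor\psi$ iff there are $t',t''$ with $t=t'\cup t''$, $M,t'\models\varphi$ and $M,t''\models\psi$;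 - $M,t\models\varphi\to\psi$ iff for all $t'\subseteq R[t]$, $M,t'\models\varphi$ implies $M,t'\models\psi$; - $M,t\models\varphi\sqcup\psi$ iff $M,t\models\varphi$ or $M,t\models\psi$. $\Phi\models_{\mathsf{InqI}}\psi$ means: for every intuitionistic Kripke model $M$ and team $t$ in $M$, if $M,t\models\varphi$ for all $\varphi\in\Phi$ then $M,t\models\psi$. Classical semantics ($\mathsf{InqB}^\lor$). A classical possible world model is $M=\langle W,V\rangle$ with $W$ a set and $V:W\times\mathcal P\to\{0,1\}$ any function; teams are sets $t\subseteq W$; support is defined by the same clauses, except that $M,t\models\varphi\to\psi$ iff for all $t'\subseteq t$, $M,t'\models\varphi$ implies $M,t'\models\psi$. $\Phi\models_{\mathsf{InqB}^\lor}\psi$ means: for every classical possible world model $M$ and team $t$ in $M$, if $M,t\models\varphi$ for all $\varphi\in\Phi$ then $M,t\models\psi$. The (finite, nonempty) set $\mathcal R(\varphi)$ of resolutions of $\varphi$ is defined by: $\mathcal R(p)=\{p\}$; $\mathcal R(\bot)=\{\bot\}$; $\mathcal R(\varphi\land\psi)=\{\alpha\land\beta\mid\alpha\in\mathcal R(\varphi),\beta\in\mathcal R(\psi)\}$; $\mathcal R(\varphi\lor\psi)=\{\alpha\lor\beta\mid\alpha\in\mathcal R(\varphi),\beta\in\mathcal R(\psi)\}$; $\mathcal R(\varphi\to\psi)=\{\bigwedge_{\alpha\in\mathcal R(\varphi)}(\alpha\to f(\alpha))\mid f:\mathcal R(\varphi)\to\mathcal R(\psi)\}$; $\mathcal R(\varphi\sqcup\psi)=\mathcal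 R(\varphi)\cup\mathcal R(\psi)$. Finite conjunctions and inquisitive disjunctions are formed in some fixed order and bracketing (immaterial up to equivalence). -}

module Defs where

open import Level using (Level; suc; Lift)
open import Data.Bool.Base using (Bool; true)
open import Data.List.Base using (List; filter)
open import Data.List.NonEmpty.Base
  using (List⁺; _∷_; [_]; _∷⁺_; _⁺++_; toList; map; concatMap; foldr; foldr₁)
import Data.List.Membership.DecPropositional as DecMembership
open import Data.Product.Base using (Σ-syntax; ∃-syntax; _×_)
open import Data.Sum.Base using (_⊎_)
open import Relation.Binary.Core using (Rel)
open import Relation.Binary.Definitions using (DecidableEquality)
open import Relation.Binary.Structures using (IsPartialOrder)
open import Relation.Binary.PropositionalEquality.Core using (_≡_; refl)
open import Relation.Nullary.Decidable.Core using (Dec; yes; no)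
open import Relation.Unary using (Pred; _∈_; _⊆_; _≐_; _∪_; ∅)

infix  9 ¬_
infixr 8 _∧_
infixr 7 _∨_
infixr 6 _⊔_
infixr 5 _⇒_

data Formula {ℓ : Level} (P : Set ℓ) : Set ℓ where
  atom            : P → Formula P
  ⊥               : Formula P
  _∧_ _∨_ _⇒_ _⊔_ : Formula P → Formula P → Formula P

¬_ : {ℓ : Level} {P : Set ℓ} → Formula P → Formula P
¬ φ = φ ⇒ ⊥

record KripkeModel {ℓ : Level} (P : Set ℓ) : Set (suc ℓ) where
  field
    World          : Set ℓ
    R              : Rel World ℓ
    isPartialOrder : IsPartialOrder _≡_ R
    V              : World → P → Bool
    persistent     : ∀ {w w′ p} → R w w′ → V w p ≡ true → V w′ p ≡ true

  R[_] : Pred World ℓ → Pred World ℓ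
  R[ t ] w′ = ∃[ w ] (w ∈ t × R w w′)

record ClassicalModel {ℓ : Level} (P : Set ℓ) : Set (suc ℓ) where
  field
    World : Set ℓ
    V     : World → P → Bool

-- Teams are predicates on worlds, so an equation between teams is read as
-- mutual inclusion _≐_.

module InqI {ℓ : Level} {P : Set ℓ} where

  module _ (M : KripkeModel P) where
    open KripkeModel M

    Supports : Pred World ℓ → Formula P → Set (suc ℓ)
    Supports t (atom p) = Lift (suc ℓ) (∀ w → w ∈ t → V w p ≡ true)
    Supports t ⊥        = Lift (suc ℓ) (t ≐ ∅)
    Supports t (φ ∧ ψ)  = Supports t φ × Supports t ψ
    Supports t (φ ∨ ψ)  = Σ[ t′ ∈ Pred World ℓ ] Σ[ t″ ∈ Pred World ℓ ]
                            (t ≐ t′ ∪ t″ × Supports t′ φ × Supports t″ ψ)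
    Supports t (φ ⇒ ψ)  = (t′ : Pred World ℓ) → t′ ⊆ R[ t ] →
                            Supports t′ φ → Supports t′ ψ
    Supports t (φ ⊔ ψ)  = Supports t φ ⊎ Supports t ψ

  infix 4 _⊨_
  _⊨_ : Pred (Formula P) ℓ → Formula P → Set (suc ℓ)
  Φ ⊨ ψ = (M : KripkeModel P) (t : Pred (KripkeModel.World M) ℓ) →
          (∀ φ → φ ∈ Φ → Supports M t φ) → Supports M t ψ

module InqB {ℓ : Level} {P : Set ℓ} where

  module _ (M : ClassicalModel P) where
    open ClassicalModel M

    Supports : Pred World ℓ → Formula P → Set (suc ℓ)
    Supports t (atom p) = Lift (suc ℓ) (∀ w → w ∈ t → V w p ≡ true)
    Supports t ⊥        = Lift (suc ℓ) (t ≐ ∅)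
    Supports t (φ ∧ ψ)  = Supports t φ × Supports t ψ
    Supports t (φ ∨ ψ)  = Σ[ t′ ∈ Pred World ℓ ] Σ[ t″ ∈ Pred World ℓ ]
                            (t ≐ t′ ∪ t″ × Supports t′ φ × Supports t″ ψ)
    Supports t (φ ⇒ ψ)  = (t′ : Pred World ℓ) → t′ ⊆ t →
                            Supports t′ φ → Supports t′ ψ
    Supports t (φ ⊔ ψ)  = Supports t φ ⊎ Supports t ψ

  infix 4 _⊨_
  _⊨_ : Pred (Formula P) ℓ → Formula P → Set (suc ℓ)
  Φ ⊨ ψ = (M : ClassicalModel P) (t : Pred (ClassicalModel.World M) ℓ) →
          (∀ φ → φ ∈ Φ → Supports M t φ) → Supports M t ψ

⋀ ⨆ : {ℓ : Level} {P : Set ℓ} → List⁺ (Formula P) → Formula P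
⋀ = foldr₁ _∧_
⨆ = foldr₁ _⊔_

-- All ways of picking one element of g x for each entry x of a list.
selections : {a b : Level} {A : Set a} {B : Set b} →
             (A → List⁺ B) → List⁺ A → List⁺ (List⁺ B)
selections g = foldr (λ x yss → concatMap (λ y → map (y ∷⁺_) yss) (g x))
                     (λ x → map [_] (g x))

-- Decidable equality of atoms is used only to keep the list of resolutions free
-- of repetitions, so that it enumerates a set.
module Resolutions {ℓ : Level} {P : Set ℓ} (_≟_ : DecidableEquality P) where

  infix 4 _≟ᶠ_
  _≟ᶠ_ : DecidableEquality (Formula P)
  atom p ≟ᶠ atom q with p ≟ q
  ... | yes refl = yes refl
  ... | no p≢q   = no λ { refl → p≢q refl }
  atom _ ≟ᶠ ⊥ = no λ ()
  atom _ ≟ᶠ (_ ∧ _) = no λ ()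
  atom _ ≟ᶠ (_ ∨ _) = no λ ()
  atom _ ≟ᶠ (_ ⇒ _) = no λ ()
  atom _ ≟ᶠ (_ ⊔ _) = no λ ()
  ⊥ ≟ᶠ atom _ = no λ ()
  ⊥ ≟ᶠ ⊥ = yes refl
  ⊥ ≟ᶠ (_ ∧ _) = no λ ()
  ⊥ ≟ᶠ (_ ∨ _) = no λ ()
  ⊥ ≟ᶠ (_ ⇒ _) = no λ ()
  ⊥ ≟ᶠ (_ ⊔ _) = no λ ()
  (_ ∧ _) ≟ᶠ atom _ = no λ ()
  (_ ∧ _) ≟ᶠ ⊥ = no λ ()
  (φ ∧ ψ) ≟ᶠ (φ′ ∧ ψ′) with φ ≟ᶠ φ′ | ψ ≟ᶠ ψ′
  ... | yes refl | yes refl = yes refl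
  ... | no φ≢φ′  | _        = no λ { refl → φ≢φ′ refl }
  ... | yes _    | no ψ≢ψ′  = no λ { refl → ψ≢ψ′ refl }
  (_ ∧ _) ≟ᶠ (_ ∨ _) = no λ ()
  (_ ∧ _) ≟ᶠ (_ ⇒ _) = no λ ()
  (_ ∧ _) ≟ᶠ (_ ⊔ _) = no λ ()
  (_ ∨ _) ≟ᶠ atom _ = no λ ()
  (_ ∨ _) ≟ᶠ ⊥ = no λ ()
  (_ ∨ _) ≟ᶠ (_ ∧ _) = no λ ()
  (φ ∨ ψ) ≟ᶠ (φ′ ∨ ψ′) with φ ≟ᶠ φ′ | ψ ≟ᶠ ψ′
  ... | yes refl | yes refl = yes refl
  ... | no φ≢φ′  | _        = no λ { refl → φ≢φ′ refl }
  ... | yes _    | no ψ≢ψ′  = no λ { refl → ψ≢ψ′ refl }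
  (_ ∨ _) ≟ᶠ (_ ⇒ _) = no λ ()
  (_ ∨ _) ≟ᶠ (_ ⊔ _) = no λ ()
  (_ ⇒ _) ≟ᶠ atom _ = no λ ()
  (_ ⇒ _) ≟ᶠ ⊥ = no λ ()
  (_ ⇒ _) ≟ᶠ (_ ∧ _) = no λ ()
  (_ ⇒ _) ≟ᶠ (_ ∨ _) = no λ ()
  (φ ⇒ ψ) ≟ᶠ (φ′ ⇒ ψ′) with φ ≟ᶠ φ′ | ψ ≟ᶠ ψ′
  ... | yes refl | yes refl = yes refl
  ... | no φ≢φ′  | _        = no λ { refl → φ≢φ′ refl }
  ... | yes _    | no ψ≢ψ′  = no λ { refl → ψ≢ψ′ refl }
  (_ ⇒ _) ≟ᶠ (_ ⊔ _) = no λ ()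
  (_ ⊔ _) ≟ᶠ atom _ = no λ ()
  (_ ⊔ _) ≟ᶠ ⊥ = no λ ()
  (_ ⊔ _) ≟ᶠ (_ ∧ _) = no λ ()
  (_ ⊔ _) ≟ᶠ (_ ∨ _) = no λ ()
  (_ ⊔ _) ≟ᶠ (_ ⇒ _) = no λ ()
  (φ ⊔ ψ) ≟ᶠ (φ′ ⊔ ψ′) with φ ≟ᶠ φ′ | ψ ≟ᶠ ψ′
  ... | yes refl | yes refl = yes refl
  ... | no φ≢φ′  | _        = no λ { refl → φ≢φ′ refl }
  ... | yes _    | no ψ≢ψ′  = no λ { refl → ψ≢ψ′ refl }

  open DecMembership _≟ᶠ_ using (_∉?_)

  infixr 5 _∪⁺_
  _∪⁺_ : List⁺ (Formula P) → List⁺ (Formula P) → List⁺ (Formula P)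
  αs ∪⁺ βs = αs ⁺++ filter (_∉? toList αs) (toList βs)

  -- In the clause for _⇒_, the entries of 𝓡 φ are pairwise distinct, hence a
  -- selection of one formula α ⇒ β (with β from 𝓡 ψ) for each entry α is the same
  -- thing as a function f from the set 𝓡 φ to the set 𝓡 ψ.
  𝓡 : Formula P → List⁺ (Formula P)
  𝓡 (atom p) = [ atom p ]
  𝓡 ⊥        = [ ⊥ ]
  𝓡 (φ ∧ ψ)  = concatMap (λ α → map (α ∧_) (𝓡 ψ)) (𝓡 φ)
  𝓡 (φ ∨ ψ)  = concatMap (λ α → map (α ∨_) (𝓡 ψ)) (𝓡 φ)
  𝓡 (φ ⇒ ψ)  = map ⋀ (selections (λ α → map (α ⇒_) (𝓡 ψ)) (𝓡 φ))
  𝓡 (φ ⊔ ψ)  = 𝓡 φ ∪⁺ 𝓡 ψ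

  infix 10 _ⁿ _ⁿˢ
  _ⁿ : Formula P → Formula P
  φ ⁿ = ⨆ (map (λ α → ¬ ¬ α) (𝓡 φ))

  _ⁿˢ : Pred (Formula P) ℓ → Pred (Formula P) ℓ
  (Φ ⁿˢ) χ = ∃[ φ ] (φ ∈ Φ × χ ≡ φ ⁿ)

{-# OPTIONS --safe #-}
-- A classical model is a Kripke model ordered by equality, so both semantics are
-- studied in Kripke models. There a team supports φ iff some resolution of φ is
-- forced at each of its worlds; hence it supports φⁿ iff ¬ ¬ α is forced at each
-- of its worlds for some α in 𝓡 φ.
--
-- If φⁿ holds in a discrete model then so does φ, which gives one direction. For
-- the other one, choose for each φ ∈ Φ an α with ¬ ¬ α forced on the team, and let
-- classical entailment act on the team of all valuations making the chosen
-- formulas true. It yields a resolution β of ψ true at all these valuations. As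
-- Φ may be infinite, ¬ ¬ β is transferred back by a compactness argument: a
-- maximal set of formulas, each finite part of which is forced somewhere above a
-- world v, is the theory of a valuation that satisfies every formula forced at v.
module Submission where

open import Defs
open import Level using (Level; suc; Lift; lift; lower; 0ℓ)
open import Axiom.ExcludedMiddle using (ExcludedMiddle)
open import Axiom.Extensionality.Propositional
  using (Extensionality; lower-extensionality)
open import Data.Bool.Base using (Bool; true; false; T)
open import Data.Bool.Properties using (T-≡)
open import Data.Empty using (⊥-elim)
import Data.Empty.Polymorphic as Polymorphic
open import Data.List.Base as List using (List; []; _∷_; _++_)
open import Data.List.Membership.Propositional using (find; lose) renaming (_∈_ to _∈ₗ_)
import Data.List.Membership.DecPropositional as DecMembership
open import Data.List.Membership.Propositional.Properties using (∈-filter⁺)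
open import Data.List.NonEmpty.Base as List⁺
  using (List⁺; _∷_; toList; concatMap)
import Data.List.Properties as List
open import Data.List.Relation.Unary.All as All using (All; []; _∷_)
import Data.List.Relation.Unary.All.Properties as All
open import Data.List.Relation.Unary.Any as Any using (Any; here; there)
import Data.List.Relation.Unary.Any.Properties as Any
open import Data.Product.Base using (∃-syntax; _×_; _,_; proj₁; proj₂)
open import Data.Sum.Base as Sum using (_⊎_; inj₁; inj₂; [_,_]′)
open import Function.Base using (_∘_; id)
open import Function.Bundles using (_⇔_; mk⇔; Equivalence)
open import Relation.Binary.Definitions using (DecidableEquality)
open import Relation.Binary.PropositionalEquality
  using (_≡_; refl; sym; cong; subst)
import Relation.Binary.PropositionalEquality.Properties as ≡
open import Relation.Binary.Structures using (IsPartialOrder)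
open import Relation.Nullary.Decidable.Core
  using (yes; no; isYes; toWitness; fromWitness; map′)
open import Relation.Nullary.Negation.Core using () renaming (¬_ to Not)
open import Relation.Unary using (Pred; _∈_; _⊆_; _∪_)

open Equivalence using (to; from)

private variable
  a b q ℓ : Level
  A B     : Set a

-- Non-empty lists

Any⁺ All⁺ : Pred A q → List⁺ A → Set _
Any⁺ Q xs = Any Q (toList xs)
All⁺ Q xs = All Q (toList xs)

toList-concatMap : (f : A → List⁺ B) (xs : List⁺ A) →
                   toList (concatMap f xs) ≡ List.concatMap (toList ∘ f) (toList xs)
toList-concatMap f (x ∷ xs) =
  cong (λ yss → toList (f x) ++ List.concat yss) (sym (List.map-∘ xs))

module _ {Q : Pred B q} where

  All-concatMap⁺ : (f : A → List⁺ B) {xs : List⁺ A} →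
                   All⁺ (All⁺ Q ∘ f) xs → All⁺ Q (concatMap f xs)
  All-concatMap⁺ f {xs} qs =
    subst (All Q) (sym (toList-concatMap f xs)) (All.concat⁺ (All.map⁺ qs))

  Any-concatMap⁺ : (f : A → List⁺ B) {xs : List⁺ A} →
                   Any⁺ (Any⁺ Q ∘ f) xs → Any⁺ Q (concatMap f xs)
  Any-concatMap⁺ f {xs} qs =
    subst (Any Q) (sym (toList-concatMap f xs)) (Any.concatMap⁺ (toList ∘ f) qs)

  Any-concatMap⁻ : (f : A → List⁺ B) {xs : List⁺ A} →
                   Any⁺ Q (concatMap f xs) → Any⁺ (Any⁺ Q ∘ f) xs
  Any-concatMap⁻ f {xs} qs =
    Any.concatMap⁻ (toList ∘ f) (subst (Any Q) (toList-concatMap f xs) qs)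

module _ {A : Set a} {B : Set b} {Q : Pred B q} (g : A → List⁺ B) where

  All-selections⁺ : ∀ xs → All⁺ (All⁺ Q ∘ g) xs →
                    All⁺ (All⁺ Q) (selections g xs)
  All-selections⁺ (x ∷ [])     (qs ∷ []) = All.map⁺ (All.map (_∷ []) qs)
  All-selections⁺ (x ∷ y ∷ xs) (qs ∷ qss) =
    All-concatMap⁺ _ (All.map (λ qz → All.map⁺ (All.map (qz ∷_) ih)) qs)
    where ih = All-selections⁺ (y ∷ xs) qss

  Any-selections⁺ : ∀ xs → All⁺ (Any⁺ Q ∘ g) xs →
                    Any⁺ (All⁺ Q) (selections g xs)
  Any-selections⁺ (x ∷ [])     (qs ∷ []) = Any.map⁺ (Any.map (_∷ []) qs)
  Any-selections⁺ (x ∷ y ∷ xs) (qs ∷ qss) =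
    Any-concatMap⁺ _ (Any.map (λ qz → Any.map⁺ (Any.map (qz ∷_) ih)) qs)
    where ih = Any-selections⁺ (y ∷ xs) qss

  Any-selections⁻ : ∀ x xs → Any⁺ (All⁺ Q) (selections g (x ∷ xs)) →
                    All (Any⁺ Q ∘ g) (x ∷ xs)
  Any-selections⁻ x []       qs = Any.map All.head (Any.map⁻ qs) ∷ []
  Any-selections⁻ x (y ∷ xs) qs =
    Any.map (All.head ∘ proj₂ ∘ Any.satisfied) qss ∷
    Any-selections⁻ y xs (Any.map All.tail (proj₂ (Any.satisfied qss)))
    where qss = Any.map Any.map⁻ (Any-concatMap⁻ _ qs)

-- Maximal consistent sets

module Maximality {ℓ : Level} (em : ExcludedMiddle ℓ) (ext : Extensionality ℓ 0ℓ) where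

  -- Subsets are Boolean-valued so that, by extensionality, mutually included ones
  -- are equal, and so that the subsets of a type form a type of the same level.
  Subset : Set ℓ → Set ℓ
  Subset X = X → Bool

  comprehension : {X : Set ℓ} → Pred X ℓ → Subset X
  comprehension Q x = isYes (em {Q x})

  module _ {X : Set ℓ} where

    infix 4 _⊑_
    _⊑_ : Subset X → Subset X → Set ℓ
    S ⊑ S′ = ∀ x → T (S x) → T (S′ x)

    ⊑-antisym : ∀ {S S′} → S ⊑ S′ → S′ ⊑ S → S ≡ S′
    ⊑-antisym {S} {S′} S⊑S′ S′⊑S = ext λ x → T-antisym (S x) (S′ x) (S⊑S′ x) (S′⊑S x)
      where
      T-antisym : ∀ c d → (T c → T d) → (T d → T c) → c ≡ d
      T-antisym true  true  _   _   = refl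
      T-antisym true  false c→d _   = ⊥-elim (c→d _)
      T-antisym false true  _   d→c = ⊥-elim (d→c _)
      T-antisym false false _   _   = refl

    ⊑-refl : ∀ {S} → S ⊑ S
    ⊑-refl _ = id

    ⊑-trans : ∀ {S S′ S″} → S ⊑ S′ → S′ ⊑ S″ → S ⊑ S″
    ⊑-trans S⊑S′ S′⊑S″ x = S′⊑S″ x ∘ S⊑S′ x

    ⋃ : Subset (Subset X) → Subset X
    ⋃ 𝓐 = comprehension λ x → ∃[ S ] (T (𝓐 S) × T (S x))

    ⋃-upper : ∀ 𝓐 {S} → T (𝓐 S) → S ⊑ ⋃ 𝓐
    ⋃-upper 𝓐 S∈𝓐 x x∈S = fromWitness (_ , S∈𝓐 , x∈S)

    ⋃-least : ∀ 𝓐 {S′} → (∀ {S} → T (𝓐 S) → S ⊑ S′) → ⋃ 𝓐 ⊑ S′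
    ⋃-least 𝓐 𝓐⊑S′ x x∈⋃ with S , S∈𝓐 , x∈S ← toWitness x∈⋃ = 𝓐⊑S′ S∈𝓐 x x∈S

    -- Bourbaki-Witt towers

    module Tower (f : Subset X → Subset X) (f-inflationary : ∀ S → S ⊑ f S) where

      -- This replaces transfinite iteration of `f`. The empty union serves as the starting point,
      -- and arbitrary unions do no harm because any two members turn out to be comparable.
      data Tower : Pred (Subset X) ℓ where
        step  : ∀ {S} → Tower S → Tower (f S)
        union : ∀ 𝓐 → (∀ {S} → T (𝓐 S) → Tower S) → Tower (⋃ 𝓐)

      -- The extreme points of the Bourbaki-Witt argument; the alternative `S ⊑ S′` takes the place
      -- of a strictness condition on `S′ ⊑ S`.
      Extreme : Pred (Subset X) ℓ
      Extreme S = ∀ {S′} → Tower S′ → S′ ⊑ S → S ⊑ S′ ⊎ f S′ ⊑ S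

      -- Induction on how `S′` is built. A step from properly below `S` stays below `S` by
      -- extremality, a step from `S` itself reaches `f S`, and a union either has a member above
      -- `f S` or has all its members below `S`.
      extreme-dichotomy : ∀ {S S′} → Extreme S → Tower S′ → S′ ⊑ S ⊎ f S ⊑ S′
      extreme-dichotomy S-ext (step {S′} S′∈) with extreme-dichotomy S-ext S′∈
      ... | inj₂ fS⊑S′ = inj₂ (⊑-trans fS⊑S′ (f-inflationary _))
      ... | inj₁ S′⊑S with S-ext S′∈ S′⊑S
      ...   | inj₁ S⊑S′ with refl ← ⊑-antisym S′⊑S S⊑S′ = inj₂ ⊑-refl
      ...   | inj₂ fS′⊑S = inj₁ fS′⊑S
      extreme-dichotomy {S} S-ext (union 𝓐 𝓐⊆)
        with em {∃[ S′ ] (T (𝓐 S′) × f S ⊑ S′)}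
      ... | yes (S′ , S′∈𝓐 , fS⊑S′) = inj₂ (⊑-trans fS⊑S′ (⋃-upper 𝓐 S′∈𝓐))
      ... | no none = inj₁ (⋃-least 𝓐 λ S′∈𝓐 →
              [ id , (λ fS⊑S′ → ⊥-elim (none (_ , S′∈𝓐 , fS⊑S′))) ]′
              (extreme-dichotomy S-ext (𝓐⊆ S′∈𝓐)))

      tower-extreme : ∀ {S} → Tower S → Extreme S
      tower-extreme (step S∈) S′∈ _ with extreme-dichotomy (tower-extreme S∈) S′∈
      ... | inj₂ fS⊑S′ = inj₁ fS⊑S′
      ... | inj₁ S′⊑S with tower-extreme S∈ S′∈ S′⊑S
      ...   | inj₁ S⊑S′ with refl ← ⊑-antisym S′⊑S S⊑S′ = inj₂ ⊑-refl
      ...   | inj₂ fS′⊑S = inj₂ (⊑-trans fS′⊑S (f-inflationary _))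
      -- Either every member of `𝓐` lies below `S′`, and so does the union, or some member `S` does
      -- not; then the dichotomy for `S`, extreme by induction, puts `f S′` below `S`.
      tower-extreme (union 𝓐 𝓐⊆) {S′} S′∈ _ with em {∃[ S ] (T (𝓐 S) × Not (S ⊑ S′))}
      ... | no none = inj₁ (⋃-least 𝓐 included)
        where
        included : ∀ {S} → T (𝓐 S) → S ⊑ S′
        included {S} S∈𝓐 with em {S ⊑ S′}
        ... | yes S⊑S′ = S⊑S′
        ... | no  S⋢S′ = ⊥-elim (none (S , S∈𝓐 , S⋢S′))
      ... | yes (S , S∈𝓐 , S⋢S′)
        with extreme-dichotomy (tower-extreme (𝓐⊆ S∈𝓐)) S′∈
      ...   | inj₂ fS⊑S′ = ⊥-elim (S⋢S′ (⊑-trans (f-inflationary _) fS⊑S′))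
      ...   | inj₁ S′⊑S with tower-extreme (𝓐⊆ S∈𝓐) S′∈ S′⊑S
      ...     | inj₁ S⊑S′  = ⊥-elim (S⋢S′ S⊑S′)
      ...     | inj₂ fS′⊑S = inj₂ (⊑-trans fS′⊑S (⋃-upper 𝓐 S∈𝓐))

      tower-total : ∀ {S S′} → Tower S → Tower S′ → S ⊑ S′ ⊎ S′ ⊑ S
      tower-total S∈ S′∈ =
        Sum.map₂ (⊑-trans (f-inflationary _))
                 (extreme-dichotomy (tower-extreme S′∈) S∈)

      top : Subset X
      top = ⋃ (comprehension Tower)

      top∈Tower : Tower top
      top∈Tower = union _ toWitness

      top-fixed : f top ⊑ top
      top-fixed = ⋃-upper _ (fromWitness (step top∈Tower))

      -- The tower is a chain, so of a set containing the head and a set containing the tail, the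
      -- larger contains both. The list is nonempty because `𝓐` might have no members.
      finite-part : ∀ 𝓐 → (∀ {S} → T (𝓐 S) → Tower S) →
                    ∀ {x xs} → All (T ∘ ⋃ 𝓐) (x ∷ xs) →
                    ∃[ S ] (T (𝓐 S) × All (T ∘ S) (x ∷ xs))
      finite-part 𝓐 𝓐⊆ (x∈ ∷ []) with S , S∈𝓐 , x∈S ← toWitness x∈ =
        S , S∈𝓐 , x∈S ∷ []
      finite-part 𝓐 𝓐⊆ (x∈ ∷ y∈ ∷ xs∈)
        with S  , S∈𝓐  , x∈S   ← toWitness x∈
           | S′ , S′∈𝓐 , xs∈S′ ← finite-part 𝓐 𝓐⊆ (y∈ ∷ xs∈)
        with tower-total (𝓐⊆ S∈𝓐) (𝓐⊆ S′∈𝓐)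
      ... | inj₁ S⊑S′ = S′ , S′∈𝓐 , S⊑S′ _ x∈S ∷ xs∈S′
      ... | inj₂ S′⊑S = S  , S∈𝓐  , x∈S ∷ All.map (S′⊑S _) xs∈S′

  -- Teichmüller–Tukey: C says which finite lists are consistent.
  module Tukey {X : Set ℓ} (C : Pred (List X) ℓ) (C-[] : C []) where

    Consistent : Subset X → Set ℓ
    Consistent S = ∀ {Δ} → All (T ∘ S) Δ → C Δ

    insert : X → Subset X → Subset X
    insert x S = comprehension λ y → y ≡ x ⊎ T (S y)

    -- Excluded middle for arbitrary types, used on a Σ-type as here, is a choice
    -- principle: it selects the element to be inserted.
    Extension : Subset X → Set ℓ
    Extension S = ∃[ x ] (Not (T (S x)) × Consistent (insert x S))

    extend : Subset X → Subset X
    extend S with em {Extension S}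
    ... | yes (x , _) = insert x S
    ... | no  _       = S

    extend-inflationary : ∀ S → S ⊑ extend S
    extend-inflationary S x x∈S with em {Extension S}
    ... | yes _ = fromWitness (inj₂ x∈S)
    ... | no  _ = x∈S

    extend-consistent : ∀ {S} → Consistent S → Consistent (extend S)
    extend-consistent {S} con with em {Extension S}
    ... | yes (_ , _ , con′) = con′
    ... | no  _              = con

    extend-fixed : ∀ {S} → extend S ⊑ S → Not (Extension S)
    extend-fixed {S} fixed e with em {Extension S}
    ... | yes (_ , x∉S , _) = x∉S (fixed _ (fromWitness (inj₁ refl)))
    ... | no  none          = none e

    open Tower extend extend-inflationary

    tower-consistent : ∀ {S} → Tower S → Consistent S
    tower-consistent (step S∈) = extend-consistent (tower-consistent S∈)
    tower-consistent (union 𝓐 𝓐⊆) [] = C-[]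
    tower-consistent (union 𝓐 𝓐⊆) (x∈ ∷ xs∈)
      with S , S∈𝓐 , xs∈S ← finite-part 𝓐 𝓐⊆ (x∈ ∷ xs∈) =
      tower-consistent (𝓐⊆ S∈𝓐) xs∈S

    -- The top of the tower is fixed by `extend`, which would have enlarged it if any new element
    -- could be inserted consistently.
    maximal : ∃[ S ] (Consistent S × (∀ x → Consistent (insert x S) → T (S x)))
    maximal = top , tower-consistent top∈Tower , complete
      where
      complete : ∀ x → Consistent (insert x top) → T (top x)
      complete x con with em {Lift ℓ (T (top x))}
      ... | yes (lift x∈) = x∈
      ... | no  x∉        = ⊥-elim (extend-fixed top-fixed (x , x∉ ∘ lift , con))

-- Forcing

module _ {P : Set ℓ} where

  module _ (M : KripkeModel P) where
    open KripkeModel M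

    -- Inquisitive disjunction is read as ordinary disjunction here, so forcing
    -- describes support only for formulas without it.
    Forces : World → Formula P → Set ℓ
    Forces w (atom p) = Lift ℓ (V w p ≡ true)
    Forces w ⊥        = Polymorphic.⊥
    Forces w (φ ∧ ψ)  = Forces w φ × Forces w ψ
    Forces w (φ ∨ ψ)  = Forces w φ ⊎ Forces w ψ
    Forces w (φ ⇒ ψ)  = ∀ u → R w u → Forces u φ → Forces u ψ
    Forces w (φ ⊔ ψ)  = Forces w φ ⊎ Forces w ψ

    TeamForces : Pred World ℓ → Formula P → Set ℓ
    TeamForces t φ = ∀ w → w ∈ t → Forces w φ

  data Standard : Formula P → Set ℓ where
    atom : ∀ p → Standard (atom p)
    ⊥    : Standard ⊥
    _∧_  : ∀ {α β} → Standard α → Standard β → Standard (α ∧ β)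
    _∨_  : ∀ {α β} → Standard α → Standard β → Standard (α ∨ β)
    _⇒_  : ∀ {α β} → Standard α → Standard β → Standard (α ⇒ β)

  Standard-⋀ : ∀ xs → All⁺ Standard xs → Standard (⋀ xs)
  Standard-⋀ (α ∷ [])     (s ∷ []) = s
  Standard-⋀ (α ∷ β ∷ xs) (s ∷ ss) = s ∧ Standard-⋀ (β ∷ xs) ss

  module Kripke (M : KripkeModel P) where
    open KripkeModel M
    module R = IsPartialOrder isPartialOrder
    open InqI using (Supports)

    infix 4 _⊩_ _⊫_
    _⊩_ = Forces M
    _⊫_ = TeamForces M

    ⊩-persistent : ∀ φ {w u} → R w u → w ⊩ φ → u ⊩ φ
    ⊩-persistent (atom p) wRu (lift v) = lift (persistent wRu v)
    ⊩-persistent (φ ∧ ψ)  wRu (x , y)  = ⊩-persistent φ wRu x , ⊩-persistent ψ wRu y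
    ⊩-persistent (φ ∨ ψ)  wRu          = Sum.map (⊩-persistent φ wRu) (⊩-persistent ψ wRu)
    ⊩-persistent (φ ⇒ ψ)  wRu f v uRv  = f v (R.trans wRu uRv)
    ⊩-persistent (φ ⊔ ψ)  wRu          = Sum.map (⊩-persistent φ wRu) (⊩-persistent ψ wRu)

    ⊩-¬¬⁺ : ∀ φ {w} → w ⊩ φ → w ⊩ ¬ ¬ φ
    ⊩-¬¬⁺ φ x u wRu n = n u R.refl (⊩-persistent φ wRu x)

    ⊫-∧⁺ : ∀ {t φ ψ} → t ⊫ φ → t ⊫ ψ → t ⊫ φ ∧ ψ
    ⊫-∧⁺ x y w w∈ = x w w∈ , y w w∈

    ⊫-∨⁺ : ∀ {t t′ t″ φ ψ} → t ⊆ t′ ∪ t″ → t′ ⊫ φ → t″ ⊫ ψ → t ⊫ φ ∨ ψ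
    ⊫-∨⁺ t⊆ x y w w∈ = Sum.map (x w) (y w) (t⊆ w∈)

    ⊫-⋀⁺ : ∀ {t} xs → All⁺ (t ⊫_) xs → t ⊫ ⋀ xs
    ⊫-⋀⁺ (α ∷ [])     (x ∷ [])  = x
    ⊫-⋀⁺ (α ∷ β ∷ xs) (x ∷ xs⊫) = ⊫-∧⁺ x (⊫-⋀⁺ (β ∷ xs) xs⊫)

    ⊫-⋀⁻ : ∀ {t} α αs → t ⊫ ⋀ (α ∷ αs) → All (t ⊫_) (α ∷ αs)
    ⊫-⋀⁻ α []       x = x ∷ []
    ⊫-⋀⁻ α (β ∷ αs) x = (λ w w∈ → proj₁ (x w w∈)) ∷ ⊫-⋀⁻ β αs (λ w w∈ → proj₂ (x w w∈))

    Supports-⨆ : ∀ {t} α αs → Supports M t (⨆ (α ∷ αs)) ⇔ Any (Supports M t) (α ∷ αs)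
    Supports-⨆ α []       = mk⇔ here λ { (here x) → x ; (there ()) }
    Supports-⨆ α (β ∷ αs) = mk⇔
      [ here , there ∘ to (Supports-⨆ β αs) ]′
      λ { (here x) → inj₁ x ; (there x) → inj₂ (from (Supports-⨆ β αs) x) }

    -- Flatness of the fragment without `⊔`. The two directions are mutual because an implication
    -- needs the opposite direction for its antecedent.
    flat⁻ : ∀ {α} → Standard α → ∀ {t} → Supports M t α → t ⊫ α
    flat⁺ : ∀ {α} → Standard α → ∀ {t} → t ⊫ α → Supports M t α

    flat⁻ (atom p) (lift f) w w∈ = lift (f w w∈)
    flat⁻ ⊥        (lift (t⊆∅ , _)) w w∈ = ⊥-elim (t⊆∅ w∈)
    flat⁻ (s ∧ s′) (x , y) = ⊫-∧⁺ (flat⁻ s x) (flat⁻ s′ y)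
    flat⁻ (s ∨ s′) (_ , _ , (t⊆ , _) , x , y) = ⊫-∨⁺ t⊆ (flat⁻ s x) (flat⁻ s′ y)
    -- The implication is tested on the singleton team of `u`.
    flat⁻ (s ⇒ s′) f w w∈ u wRu u⊩α =
      flat⁻ s′ (f (_≡ u) (λ { refl → w , w∈ , wRu }) (flat⁺ s λ { _ refl → u⊩α })) u refl

    flat⁺ (atom p) f = lift λ w w∈ → lower (f w w∈)
    flat⁺ ⊥        f = lift ((λ w∈ → Polymorphic.⊥-elim (f _ w∈)) , λ ())
    flat⁺ (s ∧ s′) f =
      flat⁺ s (λ w w∈ → proj₁ (f w w∈)) , flat⁺ s′ (λ w w∈ → proj₂ (f w w∈))
    flat⁺ (_∨_ {α} {β} s s′) {t} f =
      (λ w → w ∈ t × w ⊩ α) , (λ w → w ∈ t × w ⊩ β) ,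
      ((λ w∈ → Sum.map (w∈ ,_) (w∈ ,_) (f _ w∈)) , [ proj₁ , proj₁ ]′) ,
      flat⁺ s (λ _ → proj₂) , flat⁺ s′ (λ _ → proj₂)
    flat⁺ (s ⇒ s′) f t′ t′⊆ x = flat⁺ s′ λ u u∈ →
      let w , w∈ , wRu = t′⊆ u∈ in f w w∈ u wRu (flat⁻ s x u u∈)

  -- Classical models as discrete Kripke models

  discrete : ClassicalModel P → KripkeModel P
  discrete N = record
    { World          = World
    ; R              = _≡_
    ; isPartialOrder = record { isPreorder = ≡.isPreorder ; antisym = λ w≡u _ → w≡u }
    ; V              = V
    ; persistent     = λ { refl v → v }
    }
    where open ClassicalModel N

  discrete⁺ : ∀ N φ {t} → InqB.Supports N t φ → InqI.Supports (discrete N) t φ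
  discrete⁻ : ∀ N φ {t} → InqI.Supports (discrete N) t φ → InqB.Supports N t φ

  discrete⁺ N (atom p) x = x
  discrete⁺ N ⊥        x = x
  discrete⁺ N (φ ∧ ψ)  (x , y) = discrete⁺ N φ x , discrete⁺ N ψ y
  discrete⁺ N (φ ∨ ψ)  (t′ , t″ , eq , x , y) =
    t′ , t″ , eq , discrete⁺ N φ x , discrete⁺ N ψ y
  discrete⁺ N (φ ⇒ ψ) {t} f t′ t′⊆ x =
    discrete⁺ N ψ (f t′ (λ w∈ → let _ , u∈ , eq = t′⊆ w∈ in subst (_∈ t) eq u∈) (discrete⁻ N φ x))
  discrete⁺ N (φ ⊔ ψ)  = Sum.map (discrete⁺ N φ) (discrete⁺ N ψ)

  discrete⁻ N (atom p) x = x
  discrete⁻ N ⊥        x = x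
  discrete⁻ N (φ ∧ ψ)  (x , y) = discrete⁻ N φ x , discrete⁻ N ψ y
  discrete⁻ N (φ ∨ ψ)  (t′ , t″ , eq , x , y) =
    t′ , t″ , eq , discrete⁻ N φ x , discrete⁻ N ψ y
  discrete⁻ N (φ ⇒ ψ)  f t′ t′⊆ x =
    discrete⁻ N ψ (f t′ (λ w∈ → _ , t′⊆ w∈ , refl) (discrete⁺ N φ x))
  discrete⁻ N (φ ⊔ ψ)  = Sum.map (discrete⁻ N φ) (discrete⁻ N ψ)

  -- The only successor of `w` is `w` itself, so forcing there is classical truth.
  discrete-¬¬⁻ : ExcludedMiddle ℓ → ∀ N {w} φ →
                 Forces (discrete N) w (¬ ¬ φ) → Forces (discrete N) w φ
  discrete-¬¬⁻ em N {w} φ nn with em {Forces (discrete N) w φ}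
  ... | yes x = x
  ... | no  n = Polymorphic.⊥-elim (nn w refl λ { _ refl x → ⊥-elim (n x) })

  valuations : ClassicalModel P
  valuations = record { World = P → Bool ; V = λ v → v }

  -- A generic valuation above a world

  module _ (em : ExcludedMiddle ℓ) (ext : Extensionality ℓ 0ℓ)
           (M : KripkeModel P) (v : KripkeModel.World M) where
    open KripkeModel M
    open Kripke M
    open Maximality em ext

    ForcedAbove : Pred (List (Formula P)) ℓ
    ForcedAbove Δ = ∃[ u ] (R v u × All (u ⊩_) Δ)

    open Tukey ForcedAbove (v , R.refl , [])

    -- Removing the inserted occurrences of `φ` from `Δ` leaves `Δ′`. Consistency of `insert φ S`
    -- thus reduces to adding `φ` to finite parts of `S`.
    split-insert : ∀ {S φ Δ} → All (T ∘ insert φ S) Δ →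
                   ∃[ Δ′ ] (All (T ∘ S) Δ′ × (∀ {u} → u ⊩ φ → All (u ⊩_) Δ′ → All (u ⊩_) Δ))
    split-insert [] = [] , [] , λ _ _ → []
    split-insert (χ∈ ∷ Δ∈) with toWitness χ∈ | split-insert Δ∈
    ... | inj₁ refl | Δ′ , Δ′∈ , f = Δ′ , Δ′∈ , λ x xs → x ∷ f x xs
    ... | inj₂ χ∈S  | Δ′ , Δ′∈ , f =
      _ ∷ Δ′ , χ∈S ∷ Δ′∈ , λ { x (y ∷ xs) → y ∷ f x xs }

    module _ {S : Subset (Formula P)} (consistent : Consistent S)
             (complete : ∀ φ → Consistent (insert φ S) → T (S φ)) where

      contains : ∀ φ → (∀ {Δ} → All (T ∘ S) Δ → ForcedAbove (φ ∷ Δ)) → T (S φ)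
      contains φ extendable = complete φ λ Δ∈ →
        let Δ′ , Δ′∈ , f = split-insert Δ∈
            u , vRu , xs = extendable Δ′∈
        in u , vRu , f (All.head xs) (All.tail xs)

      closed : ∀ {Δ} φ → All (T ∘ S) Δ →
               (∀ {u} → R v u → All (u ⊩_) Δ → u ⊩ φ) → T (S φ)
      closed {Δ} φ Δ∈ Δ⊩φ = contains φ λ Δ′∈ →
        let u , vRu , xs = consistent (All.++⁺ Δ∈ Δ′∈)
        in u , vRu , Δ⊩φ vRu (All.++⁻ˡ Δ xs) ∷ All.++⁻ʳ Δ xs

      -- If some finite part `Δ` of `S` is never forced together with `φ` above `v`, then worlds
      -- above `v` forcing `Δ` force `¬ φ`. Otherwise `φ` is consistent with `S`, and maximality
      -- applies.
      negation-complete : ∀ φ → T (S φ) ⊎ T (S (¬ φ))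
      negation-complete φ with em {∃[ Δ ] (All (T ∘ S) Δ × Not (ForcedAbove (φ ∷ Δ)))}
      ... | yes (Δ , Δ∈ , unforced) = inj₂ (closed (¬ φ) Δ∈ λ vRu xs w uRw x →
              ⊥-elim (unforced (w , R.trans vRu uRw ,
                x ∷ All.map (λ {χ} → ⊩-persistent χ uRw) xs)))
      ... | no  none = inj₁ (contains φ forced)
        where
        forced : ∀ {Δ} → All (T ∘ S) Δ → ForcedAbove (φ ∷ Δ)
        forced {Δ} Δ∈ with em {ForcedAbove (φ ∷ Δ)}
        ... | yes x = x
        ... | no  n = ⊥-elim (none (Δ , Δ∈ , n))

      -- Were neither disjunct in `S`, both negations would be, and a single world would force them
      -- along with `χ`. Keeping `χ` general covers `∨` and `⊔` at once.
      prime : ∀ φ ψ {χ} → T (S χ) → (∀ {u} → u ⊩ χ → u ⊩ φ ⊎ u ⊩ ψ) → T (S φ) ⊎ T (S ψ)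
      prime φ ψ χ∈ χ⊩ with negation-complete φ | negation-complete ψ
      ... | inj₁ φ∈  | _         = inj₁ φ∈
      ... | inj₂ _   | inj₁ ψ∈   = inj₂ ψ∈
      ... | inj₂ ¬φ∈ | inj₂ ¬ψ∈ with consistent (χ∈ ∷ ¬φ∈ ∷ ¬ψ∈ ∷ [])
      ...   | u , _ , x ∷ n ∷ n′ ∷ [] =
        Polymorphic.⊥-elim ([ n u R.refl , n′ u R.refl ]′ (χ⊩ x))

      truth : ∀ φ → T (S φ) ⇔ Forces (discrete valuations) (S ∘ atom) φ
      truth (atom p) = mk⇔ (lift ∘ to T-≡) (from T-≡ ∘ lower)
      truth ⊥        = mk⇔
        (λ ⊥∈ → let _ , _ , xs = consistent (⊥∈ ∷ []) in Polymorphic.⊥-elim (All.head xs))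
        (λ ())
      truth (φ ∧ ψ)  = mk⇔
        (λ φψ∈ → to (truth φ) (closed φ (φψ∈ ∷ []) λ _ → proj₁ ∘ All.head) ,
                 to (truth ψ) (closed ψ (φψ∈ ∷ []) λ _ → proj₂ ∘ All.head))
        (λ (x , y) → closed (φ ∧ ψ) (from (truth φ) x ∷ from (truth ψ) y ∷ [])
          λ { _ (x′ ∷ y′ ∷ []) → x′ , y′ })
      truth (φ ∨ ψ)  = mk⇔
        (λ φψ∈ → Sum.map (to (truth φ)) (to (truth ψ)) (prime φ ψ φψ∈ id))
        [ (λ x → closed (φ ∨ ψ) (from (truth φ) x ∷ []) λ _ → inj₁ ∘ All.head)
        , (λ y → closed (φ ∨ ψ) (from (truth ψ) y ∷ []) λ _ → inj₂ ∘ All.head) ]′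
      truth (φ ⊔ ψ)  = mk⇔
        (λ φψ∈ → Sum.map (to (truth φ)) (to (truth ψ)) (prime φ ψ φψ∈ id))
        [ (λ x → closed (φ ⊔ ψ) (from (truth φ) x ∷ []) λ _ → inj₁ ∘ All.head)
        , (λ y → closed (φ ⊔ ψ) (from (truth ψ) y ∷ []) λ _ → inj₂ ∘ All.head) ]′
      truth (φ ⇒ ψ)  = mk⇔
        (λ { φψ∈ _ refl x → to (truth ψ) (closed ψ (φψ∈ ∷ from (truth φ) x ∷ [])
          λ { _ (f ∷ y ∷ []) → f _ R.refl y }) })
        -- The implication follows from `ψ` if `φ` is in `S`, and from `¬ φ` otherwise; this makes
        -- it classical at the valuation.
        λ f → [ (λ φ∈ → closed (φ ⇒ ψ) (from (truth ψ) (f _ refl (to (truth φ) φ∈)) ∷ [])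
                  λ { _ (y ∷ []) _ uRw _ → ⊩-persistent ψ uRw y })
              , (λ ¬φ∈ → closed (φ ⇒ ψ) (¬φ∈ ∷ [])
                  λ { _ (n ∷ []) w uRw x → Polymorphic.⊥-elim (n w uRw x) })
              ]′ (negation-complete φ)

    generic-valuation : ∃[ U ] (∀ φ → v ⊩ φ → Forces (discrete valuations) U φ)
    generic-valuation =
      let S , consistent , complete = maximal in
      S ∘ atom , λ φ x → to (truth consistent complete φ)
        -- By persistence `φ` holds at every world above `v`, so it enters `S` from no premises.
        (closed consistent complete φ [] λ vRu _ → ⊩-persistent φ vRu x)

-- Resolutions

module _ {P : Set ℓ} (_≟_ : DecidableEquality P) where
  open Resolutions _≟_
  open DecMembership _≟ᶠ_ using (_∈?_; _∉?_)

  module _ {Q : Pred (Formula P) q} where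

    Any-∪⁺⁺ : ∀ αs βs → Any⁺ Q αs ⊎ Any⁺ Q βs → Any⁺ Q (αs ∪⁺ βs)
    Any-∪⁺⁺ αs βs (inj₁ x) = Any.++⁺ˡ x
    Any-∪⁺⁺ αs βs (inj₂ x) with find x
    ... | β , β∈βs , qβ with β ∈? toList αs
    ...   | yes β∈αs = Any.++⁺ˡ (lose β∈αs qβ)
    ...   | no  β∉αs =
      Any.++⁺ʳ (toList αs) (lose (∈-filter⁺ (_∉? toList αs) β∈βs β∉αs) qβ)

    Any-∪⁺⁻ : ∀ αs βs → Any⁺ Q (αs ∪⁺ βs) → Any⁺ Q αs ⊎ Any⁺ Q βs
    Any-∪⁺⁻ αs βs x =
      Sum.map₂ (Any.filter⁻ (_∉? toList αs)) (Any.++⁻ (toList αs) x)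

  𝓡-standard : ∀ φ → All⁺ Standard (𝓡 φ)
  𝓡-standard (atom p) = atom p ∷ []
  𝓡-standard ⊥        = ⊥ ∷ []
  𝓡-standard (φ ∧ ψ)  =
    All-concatMap⁺ _ (All.map (λ s → All.map⁺ (All.map (s ∧_) (𝓡-standard ψ))) (𝓡-standard φ))
  𝓡-standard (φ ∨ ψ)  =
    All-concatMap⁺ _ (All.map (λ s → All.map⁺ (All.map (s ∨_) (𝓡-standard ψ))) (𝓡-standard φ))
  𝓡-standard (φ ⇒ ψ)  =
    All.map⁺ (All.map (λ {αs} → Standard-⋀ αs) (All-selections⁺ _ (𝓡 φ)
      (All.map (λ s → All.map⁺ (All.map (s ⇒_) (𝓡-standard ψ))) (𝓡-standard φ))))
  𝓡-standard (φ ⊔ ψ)  =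
    All.++⁺ (𝓡-standard φ) (All.filter⁺ (_∉? toList (𝓡 φ)) (𝓡-standard ψ))

  module _ (M : KripkeModel P) where
    open KripkeModel M
    open Kripke M
    open InqI using (Supports)

    -- The two directions are mutual because implication reverses the roles for its antecedent.
    resolve   : ∀ φ {t} → Supports M t φ → Any⁺ (t ⊫_) (𝓡 φ)
    unresolve : ∀ φ {t} → Any⁺ (t ⊫_) (𝓡 φ) → Supports M t φ

    resolve (atom p) x = here (flat⁻ (atom p) x)
    resolve ⊥        x = here (flat⁻ ⊥ x)
    resolve (φ ∧ ψ)  (x , y) = Any-concatMap⁺ _
      (Any.map (λ x′ → Any.map⁺ (Any.map (⊫-∧⁺ x′) (resolve ψ y)))
               (resolve φ x))
    resolve (φ ∨ ψ)  (_ , _ , (t⊆ , _) , x , y) = Any-concatMap⁺ _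
      (Any.map (λ x′ → Any.map⁺ (Any.map (⊫-∨⁺ t⊆ x′) (resolve ψ y)))
               (resolve φ x))
    resolve (φ ⊔ ψ)  x = Any-∪⁺⁺ (𝓡 φ) (𝓡 ψ) (Sum.map (resolve φ) (resolve ψ) x)
    resolve (φ ⇒ ψ) {t} f = Any.map⁺ (Any.map (λ {αs} → ⊫-⋀⁺ αs)
      (Any-selections⁺ _ (𝓡 φ) (All.tabulate λ α∈ → Any.map⁺ (choose α∈))))
      where
      choose : ∀ {α} → α ∈ₗ toList (𝓡 φ) → Any⁺ (λ β → t ⊫ α ⇒ β) (𝓡 ψ)
      choose {α} α∈ =
        Any.map (λ x w w∈ u wRu u⊩α → x u ((w , w∈ , wRu) , u⊩α))
          -- The largest subteam of `R[ t ]` forcing `α` supports `φ`. A resolution of `ψ` found for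
          -- it works uniformly at all successors forcing `α`.
          (resolve ψ (f (λ u → u ∈ R[ t ] × u ⊩ α) proj₁ (unresolve φ (lose α∈ λ _ → proj₂))))

    unresolve (atom p) (here x) = flat⁺ (atom p) x
    unresolve ⊥        (here x) = flat⁺ ⊥ x
    unresolve (φ ∧ ψ)  x
      with α , α∈ , y ← find (Any-concatMap⁻ _ {𝓡 φ} x)
      with β , β∈ , z ← find (Any.map⁻ y) =
      unresolve φ (lose α∈ λ w w∈ → proj₁ (z w w∈)) ,
      unresolve ψ (lose β∈ λ w w∈ → proj₂ (z w w∈))
    unresolve (φ ∨ ψ) {t} x
      with α , α∈ , y ← find (Any-concatMap⁻ _ {𝓡 φ} x)
      with β , β∈ , z ← find (Any.map⁻ y) =
      -- The team is split, with possible overlap, according to the disjunct forced at each world.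
      (λ w → w ∈ t × w ⊩ α) , (λ w → w ∈ t × w ⊩ β) ,
      ((λ w∈ → Sum.map (w∈ ,_) (w∈ ,_) (z _ w∈)) , [ proj₁ , proj₁ ]′) ,
      unresolve φ (lose α∈ λ _ → proj₂) , unresolve ψ (lose β∈ λ _ → proj₂)
    unresolve (φ ⊔ ψ)  x = Sum.map (unresolve φ) (unresolve ψ) (Any-∪⁺⁻ (𝓡 φ) (𝓡 ψ) x)
    unresolve (φ ⇒ ψ) {t} x t′ t′⊆ y
      -- The resolution `α` forced throughout `t′` determines which selected conjunct `α ⇒ β` to
      -- apply.
      with α , α∈ , y′ ← find (resolve φ y) =
      unresolve ψ (Any.map
        (λ z u u∈ → let w , w∈ , wRu = t′⊆ u∈ in z w w∈ u wRu (y′ u u∈))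
        (Any.map⁻ (All.lookup choices α∈)))
      where
      choices : All⁺ (λ α → Any⁺ (t ⊫_) (List⁺.map (α ⇒_) (𝓡 ψ))) (𝓡 φ)
      choices = Any-selections⁻ _ _ _ (Any.map (⊫-⋀⁻ _ _) (Any.map⁻ x))

    -- Each `¬ ¬ α` is standard, so flatness applies to every inquisitive disjunct separately.
    Supports-ⁿ : ∀ φ {t} → Supports M t (φ ⁿ) ⇔ Any⁺ (λ α → t ⊫ ¬ ¬ α) (𝓡 φ)
    Supports-ⁿ φ = mk⇔
      (λ x → let α , α∈ , y = find (Any.map⁻ (to (Supports-⨆ _ _) x))
             in lose α∈ (flat⁻ (¬¬-standard α∈) y))
      (λ x → let α , α∈ , y = find x
             in from (Supports-⨆ _ _) (Any.map⁺ (lose α∈ (flat⁺ (¬¬-standard α∈) y))))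
      where
      ¬¬-standard : ∀ {α} → α ∈ₗ toList (𝓡 φ) → Standard (¬ ¬ α)
      ¬¬-standard α∈ = (All.lookup (𝓡-standard φ) α∈ ⇒ ⊥) ⇒ ⊥

  -- The two directions of the equivalence

  module _ (em : ExcludedMiddle ℓ) (Φ : Pred (Formula P) ℓ) (ψ : Formula P) where

    B⇒I : Extensionality ℓ 0ℓ → Φ InqB.⊨ ψ → Φ ⁿˢ InqI.⊨ ψ ⁿ
    B⇒I ext Φ⊨ψ M t t⊨Φⁿ = from (Supports-ⁿ M ψ) (Any.map ¬¬-transfer ψ-resolved)
      where
      open Kripke M

      chosen : ∀ φ → φ ∈ Φ → ∃[ α ] (α ∈ₗ toList (𝓡 φ) × t ⊫ ¬ ¬ α)
      chosen φ φ∈ = find (to (Supports-ⁿ M φ) (t⊨Φⁿ (φ ⁿ) (φ , φ∈ , refl)))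

      -- The formula chosen for `φ` may depend on the membership proof, so the team ranges over
      -- these proofs as well.
      s : Pred (P → Bool) ℓ
      s U = ∀ φ (φ∈ : φ ∈ Φ) → Forces (discrete valuations) U (proj₁ (chosen φ φ∈))

      s⊨Φ : ∀ φ → φ ∈ Φ → InqB.Supports valuations s φ
      s⊨Φ φ φ∈ = discrete⁻ valuations φ
        (unresolve _ φ (lose (proj₁ (proj₂ (chosen φ φ∈))) λ _ U∈s → U∈s φ φ∈))

      ψ-resolved : Any⁺ (TeamForces (discrete valuations) s) (𝓡 ψ)
      ψ-resolved = resolve _ ψ (discrete⁺ valuations ψ (Φ⊨ψ valuations s s⊨Φ))

      ¬¬-transfer : ∀ {β} → TeamForces (discrete valuations) s β → t ⊫ ¬ ¬ β
      ¬¬-transfer {β} s⊫β w w∈ v wRv v⊩¬β =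
        -- If `v` above `w` forced `¬ β`, a generic valuation above `v` would refute `β`. Yet it
        -- satisfies every chosen `¬ ¬ α`, hence `α`, and so lies in `s`, where `β` is true.
        let U , U⊩ = generic-valuation em ext M v
            U∈s    = λ φ φ∈ → let α , _ , t⊫¬¬α = chosen φ φ∈ in
              discrete-¬¬⁻ em valuations α
                (U⊩ (¬ ¬ α) (⊩-persistent (¬ ¬ α) wRv (t⊫¬¬α w w∈)))
        in Polymorphic.⊥-elim (U⊩ (¬ β) v⊩¬β U refl (s⊫β U U∈s))

    I⇒B : Φ ⁿˢ InqI.⊨ ψ ⁿ → Φ InqB.⊨ ψ
    I⇒B Φⁿ⊨ψⁿ N t t⊨Φ =
      discrete⁻ N ψ (unresolve M ψ (Any.map (λ {β} y w w∈ → discrete-¬¬⁻ em N β (y w w∈))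
        (to (Supports-ⁿ M ψ) (Φⁿ⊨ψⁿ M t t⊨Φⁿ))))
      where
      M = discrete N
      open Kripke M

      t⊨Φⁿ : ∀ χ → χ ∈ Φ ⁿˢ → InqI.Supports M t χ
      t⊨Φⁿ _ (φ , φ∈ , refl) = from (Supports-ⁿ M φ)
        (Any.map (λ {α} x w w∈ → ⊩-¬¬⁺ α (x w w∈))
          (resolve M φ (discrete⁺ N φ (t⊨Φ φ φ∈))))

proposition4p24 : {ℓ : Level} → ExcludedMiddle (suc ℓ) → Extensionality (suc ℓ) (suc ℓ) →
    (P : Set ℓ) (_≟_ : DecidableEquality P) →
    let open Resolutions _≟_ in
    (Φ : Pred (Formula P) ℓ) (ψ : Formula P) →
    (Φ InqB.⊨ ψ) ⇔ ((Φ ⁿˢ) InqI.⊨ (ψ ⁿ))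
proposition4p24 {ℓ} em ext P _≟_ Φ ψ =
  mk⇔ (B⇒I _≟_ em-ℓ Φ ψ (lower-extensionality (suc ℓ) (suc ℓ) ext)) (I⇒B _≟_ em-ℓ Φ ψ)
  where
  em-ℓ : ExcludedMiddle ℓ
  em-ℓ = map′ lower (lift {ℓ = suc ℓ}) em
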